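{- Each of the following graph operations $\gamma$ preserves well-quasi-orderability by the labelled induced subgraph relation: (i) subgraph complementation; (ii) bipartite complementation; (iii) vertex deletion.
   Context: Graphs are finite, undirected and simple. Operations. Subgraph complementation in a graph $G$: choose a subset $S\subseteq V(G)$ and complement the subgraph of $G$ induced by $S$ (i.e. two distinct vertices of $S$ become adjacent iff they were non-adjacent; all other adjacencies are unchanged). Bipartite complementation in $G$: choose two disjoint subsets $X,Y\subseteq V(G)$ and complement the edges between $X$ and $Y$ (i.e. $x\in X$ and $y\in Y$ become adjacent iff they were non-adjacent; all other adjacencies are unchanged). Vertex deletion in $G$: remove a single vertex together with all edges incident to it. Let $k\geq 0$ be a constant and let $\gamma$ be a graph operation. A graph class $\mathcal{G}'$ is $(k,\gamma)$-obtained from a graph class $\mathcal{G}$ if (a) every graph in $\mathcal{G}'$ is obtained from a graph in $\mathcal{G}$ by performing $\gamma$ at most $k$ times, and (b) for every $G\in\mathcal{G}$ there exists at least one graph in $\mathcal{G}'$ obtained from $G$ by performing $\gamma$ at most $k$ times. The operation $\gamma$ preserves well-quasi-orderability by the labelled induced subgraph relation if for any finite constant $k$ and any graph class $\mathcal{G}$, any graph class $\mathcal{G}'$ that is $(k,\gamma)$-obtained from $\mathcal{G}$ is well-quasi-ordered by this relation if and only if $\mathcal{G}$ is. (Graph classes here need not be closed under induced subgraphs.) A quasi-order is a reflexive, transitive relation. A quasi-order $\leq$ on a set $W$ is a well-quasi-order if every infinite sequence $x_1,x_2,\ldots$ in $W$ contains a pair with $x_i\leq x_j$, $i<j$ (equivalently: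 no infinite strictly decreasing sequence and no infinite antichain, an antichain being a set of pairwise incomparable elements). Given a quasi-order $(W,\leq)$, a labelled graph is a graph $G$ in which each vertex $v$ is assigned a label $l_G(v)\in W$. For labelled graphs $G,H$, $G$ is a labelled induced subgraph of $H$ if there is an isomorphism from $G$ to an induced subgraph of $H$ mapping each vertex $v$ of $G$ to a vertex $w$ of $H$ with $l_G(v)\leq l_H(w)$. A class $X$ of graphs is well-quasi-ordered by the labelled induced subgraph relation if, for every well-quasi-order $(W,\leq)$, there is no infinite antichain (with respect to the labelled induced subgraph relation) of graphs from $X$ labelled with elements of $W$. -}

module Defs where

open import Data.Bool.Base using (Bool; true; false; not; _∧_; _∨_; if_then_else_)
open import Data.Bool.Properties using (∧-comm; ∨-comm; ∧-zeroʳ)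
open import Data.Fin.Base using (Fin)
open import Data.Fin.Properties using (_≟_)
open import Data.Fin.Subset using (Subset; _∈_; _∩_; ∁; ⁅_⁆; Empty)
open import Data.Fin.Subset.Properties using (x∈p∩q⁺)
open import Data.Nat.Base using (ℕ; suc; _<_)
open import Data.Product using (Σ-syntax; ∃-syntax; ∃₂; _×_; _,_; proj₁)
open import Data.Vec.Base using (lookup)
open import Data.Vec.Properties using (lookup⇒[]=)
open import Function.Bundles using (_↔_; _⇔_; Inverse)
open import Level using (Level; 0ℓ) renaming (suc to lsuc)
open import Relation.Binary.Core using (Rel)
open import Relation.Binary.Structures using (IsPreorder)
open import Relation.Binary.PropositionalEquality
  using (_≡_; _≢_; refl; sym; trans; cong; cong₂)
open import Relation.Nullary using (¬_; contradiction; yes; no; ⌊_⌋)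
open import Relation.Unary using (Pred)

private
  variable
    ℓ : Level
    n : ℕ
    V V′ : Set

record Graph (V : Set) : Set where
  field
    adj        : V → V → Bool
    adj-sym    : ∀ u v → adj u v ≡ adj v u
    adj-irrefl : ∀ v → adj v v ≡ false

open Graph public

record _≅_ (G : Graph V) (H : Graph V′) : Set where
  field
    bijection    : V ↔ V′
  open Inverse bijection public using (to; from)
  field
    preservesAdj : ∀ u v → adj H (to u) (to v) ≡ adj G u v

-- Up to isomorphism, a finite vertex set is some Fin n.
record FiniteGraph : Set where
  constructor finiteGraph
  field
    {order} : ℕ
    graph   : Graph (Fin order)

open FiniteGraph public

_[_] : Graph (Fin n) → (S : Subset n) → Graph (∃[ v ] v ∈ S)
G [ S ] = record
  { adj        = λ u v → adj G (proj₁ u) (proj₁ v)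
  ; adj-sym    = λ u v → adj-sym G (proj₁ u) (proj₁ v)
  ; adj-irrefl = λ v → adj-irrefl G (proj₁ v)
  }

toggle : (G : Graph V) (P : V → V → Bool) →
         (∀ u v → P u v ≡ P v u) → (∀ v → P v v ≡ false) → Graph V
toggle G P P-sym P-irrefl = record
  { adj        = λ u v → flipIf (P u v) (adj G u v)
  ; adj-sym    = λ u v → cong₂ flipIf (P-sym u v) (adj-sym G u v)
  ; adj-irrefl = λ v → cong₂ flipIf (P-irrefl v) (adj-irrefl G v)
  }
  where
  flipIf : Bool → Bool → Bool
  flipIf b e = if b then not e else e

distinct : Fin n → Fin n → Bool
distinct u v = not ⌊ u ≟ v ⌋

distinct-sym : (u v : Fin n) → distinct u v ≡ distinct v u
distinct-sym u v with u ≟ v | v ≟ u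
... | yes _   | yes _   = refl
... | no _    | no _    = refl
... | yes u≡v | no v≢u  = contradiction (sym u≡v) v≢u
... | no u≢v  | yes v≡u = contradiction (sym v≡u) u≢v

distinct-irrefl : (v : Fin n) → distinct v v ≡ false
distinct-irrefl v with v ≟ v
... | yes _  = refl
... | no v≢v = contradiction refl v≢v

complementOn : Graph (Fin n) → Subset n → Graph (Fin n)
complementOn G S = toggle G
  (λ u v → (lookup S u ∧ lookup S v) ∧ distinct u v)
  (λ u v → cong₂ _∧_ (∧-comm (lookup S u) (lookup S v)) (distinct-sym u v))
  (λ v → trans (cong ((lookup S v ∧ lookup S v) ∧_) (distinct-irrefl v))
               (∧-zeroʳ (lookup S v ∧ lookup S v)))

disjoint⇒false : (X Y : Subset n) → Empty (X ∩ Y) →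
                 ∀ v → lookup X v ∧ lookup Y v ≡ false
disjoint⇒false X Y X∩Y=∅ v with lookup X v in v∈X | lookup Y v in v∈Y
... | false | _     = refl
... | true  | false = refl
... | true  | true  =
  contradiction (v , x∈p∩q⁺ (lookup⇒[]= v X v∈X , lookup⇒[]= v Y v∈Y)) X∩Y=∅

complementBetween : Graph (Fin n) → (X Y : Subset n) → Empty (X ∩ Y) →
                    Graph (Fin n)
complementBetween G X Y X∩Y=∅ = toggle G
  (λ u v → (lookup X u ∧ lookup Y v) ∨ (lookup X v ∧ lookup Y u))
  (λ u v → ∨-comm (lookup X u ∧ lookup Y v) (lookup X v ∧ lookup Y u))
  (λ v → cong₂ _∨_ (disjoint⇒false X Y X∩Y=∅ v) (disjoint⇒false X Y X∩Y=∅ v))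

-- γ G H: the graph H is, up to isomorphism, a result of performing γ once on G.
GraphOperation : Set₁
GraphOperation = Rel FiniteGraph 0ℓ

subgraphComplementation : GraphOperation
subgraphComplementation G H =
  ∃[ S ] (graph H ≅ complementOn (graph G) S)

bipartiteComplementation : GraphOperation
bipartiteComplementation G H =
  ∃₂ λ X Y → Σ[ X∩Y=∅ ∈ Empty (X ∩ Y) ]
    (graph H ≅ complementBetween (graph G) X Y X∩Y=∅)

vertexDeletion : GraphOperation
vertexDeletion G H =
  ∃[ v ] (graph H ≅ (graph G [ ∁ ⁅ v ⁆ ]))

-- H arises from G by performing γ at most k times.
data AtMost (γ : GraphOperation) : ℕ → Rel FiniteGraph 0ℓ where
  stop : ∀ {k G H} → graph G ≅ graph H → AtMost γ k G H
  step : ∀ {k G H K} → γ G H → AtMost γ k H K → AtMost γ (suc k) G K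

-- Classes are not required to be closed under isomorphism, nor under
-- induced subgraphs.
GraphClass : (ℓ : Level) → Set (lsuc ℓ)
GraphClass ℓ = Pred FiniteGraph ℓ

record Obtained (k : ℕ) (γ : GraphOperation) (𝒢 𝒢′ : GraphClass ℓ) : Set ℓ where
  field
    every-from : ∀ H → 𝒢′ H → ∃[ G ] (𝒢 G × AtMost γ k G H)
    every-to   : ∀ G → 𝒢 G → ∃[ H ] (𝒢′ H × AtMost γ k G H)

record IsWellQuasiOrder {W : Set ℓ} (_≤_ : Rel W ℓ) : Set ℓ where
  field
    isQuasiOrder : IsPreorder _≡_ _≤_
    goodPair     : (x : ℕ → W) → ∃₂ λ i j → i < j × x i ≤ x j

record LabelledGraph (W : Set ℓ) : Set ℓ where
  field
    underlying : FiniteGraph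
    label      : Fin (order underlying) → W

open LabelledGraph public

LabelledInducedSubgraph : {W : Set ℓ} → Rel W ℓ → Rel (LabelledGraph W) ℓ
LabelledInducedSubgraph _≤_ G H =
  Σ[ S ∈ Subset (order (underlying H)) ]
  Σ[ f ∈ graph (underlying G) ≅ (graph (underlying H) [ S ]) ]
    (∀ v → label G v ≤ label H (proj₁ (_≅_.to f v)))

-- The terms are distinct whenever _≲_ is reflexive, so the sequence
-- enumerates an infinite set.
InfiniteAntichain : {A : Set ℓ} → Rel A ℓ → (ℕ → A) → Set ℓ
InfiniteAntichain _≲_ x = ∀ i j → i ≢ j → ¬ (x i ≲ x j)

LabelledWQO : GraphClass ℓ → Set (lsuc ℓ)
LabelledWQO {ℓ} 𝒢 =
  (W : Set ℓ) (_≤_ : Rel W ℓ) → IsWellQuasiOrder _≤_ →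
  ¬ (Σ[ x ∈ (ℕ → LabelledGraph W) ]
       ((∀ i → 𝒢 (underlying (x i))) ×
        InfiniteAntichain (LabelledInducedSubgraph _≤_) x))

PreservesLabelledWQO : (ℓ : Level) → GraphOperation → Set (lsuc ℓ)
PreservesLabelledWQO ℓ γ =
  (k : ℕ) (𝒢 𝒢′ : GraphClass ℓ) → Obtained k γ 𝒢 𝒢′ →
  LabelledWQO 𝒢′ ⇔ LabelledWQO 𝒢

{-# OPTIONS --safe #-}
-- Two graphs that differ by one operation determine each other once finitely
-- much information is stored in the labels, so an antichain of labelled graphs
-- on one side gives an antichain on the other side, labelled by a richer
-- well-quasi-order.  For both complementations this information is membership
-- in the two vertex sets; for a graph that has lost a vertex it is, at every
-- remaining vertex, the label of the lost vertex and the adjacency to it;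
-- for a graph that is about to lose a vertex it is a mark on that vertex.
-- At most k operations are handled one at a time, through intermediate classes.

module Submission where

open import Defs
open import Axiom.ExcludedMiddle using (ExcludedMiddle)
open import Data.Bool.Base using (Bool; true; false; not; _∧_; _∨_; _xor_; if_then_else_)
open import Data.Bool.Properties
  using (∧-comm; ∧-identityʳ; ∨-idem; xor-assoc; xor-same; ¬-not)
open import Data.Fin.Base using (Fin; zero)
open import Data.Fin.Properties using (_≟_; any?)
open import Data.Fin.Subset using (Subset; _∈_; ∁; ⁅_⁆)
open import Data.Fin.Subset.Properties using (x∈⁅x⁆; x∈⁅y⁆⇒x≡y; x∈∁p⇒x∉p; x∉p⇒x∈∁p)
open import Data.Maybe.Base using (Maybe; just; nothing)
import Data.Maybe.Base as Maybe
open import Data.Maybe.Properties using (map-injective; just-injective)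
open import Data.Maybe.Relation.Binary.Pointwise using (Pointwise; just; nothing)
import Data.Maybe.Relation.Binary.Pointwise as Pointwise
open import Data.Nat.Base using (ℕ; zero; suc; _+_; _≤_; _<_; z<s)
open import Data.Nat.GeneralisedArithmetic using (fold)
open import Data.Nat.Properties
  using (<-trans; <-irrefl; <⇒≤; ≤-trans; ≤-refl; m≤m+n; +-monoʳ-<; m<1+n⇒m<n∨m≡n; <-cmp)
open import Data.Product using (Σ-syntax; ∃-syntax; _×_; _,_; proj₁; proj₂)
open import Data.Product.Properties using (Σ-≡,≡→≡)
open import Data.Sum.Base using (_⊎_; inj₁; inj₂; [_,_]′)
open import Data.Vec.Base using (lookup; tabulate)
open import Data.Vec.Properties using ([]=⇒lookup; lookup⇒[]=; lookup∘tabulate)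
open import Data.Vec.Properties.WithK using ([]=-irrelevant)
open import Function.Base using (_∘_; flip; const)
open import Function.Bundles using (_↔_; Inverse; Injection; mk↔ₛ′; mk⇔)
open import Function.Construct.Symmetry using (↔-sym)
open import Function.Definitions using (Injective)
open import Function.Properties.Inverse using (↔⇒↣)
open import Level using (Level; Lift; lift; lower) renaming (suc to lsuc)
open import Relation.Binary.Core using (Rel)
open import Relation.Binary.Definitions using (Transitive; tri<; tri≈; tri>)
open import Relation.Binary.Structures using (IsPreorder)
open import Relation.Binary.PropositionalEquality hiding ([_])
open import Relation.Nullary using (¬_; contradiction; yes; no; ⌊_⌋)
open import Relation.Nullary.Decidable using (decidable-stable; dec-true; isYes≗does)
open import Relation.Unary using (Pred)

private
  variable
    a ℓ : Level
    m n : ℕ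

↔-injective : {A B : Set} (f : A ↔ B) → Injective _≡_ _≡_ (Inverse.to f)
↔-injective f = Injection.injective (↔⇒↣ f)

-- Embeddings as injective maps

-- With the subset absorbed into an injective map, decoding only has to compose functions between
-- `Fin` types.
record LabelledEmbedding {W : Set ℓ} (_≤_ : Rel W ℓ) (G H : LabelledGraph W) : Set ℓ where
  field
    map       : Fin (order (underlying G)) → Fin (order (underlying H))
    injective : Injective _≡_ _≡_ map
    map-adj   : ∀ u v → adj (graph (underlying H)) (map u) (map v) ≡
                        adj (graph (underlying G)) u v
    map-label : ∀ v → label G v ≤ label H (map v)

module _ (f : Fin m → Fin n) where

  image : Subset n
  image = tabulate λ w → ⌊ any? (λ v → f v ≟ w) ⌋

  ∈-image : ∀ v → f v ∈ image
  ∈-image v = lookup⇒[]= (f v) image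
    (trans (lookup∘tabulate _ (f v))
      (trans (isYes≗does (any? _)) (dec-true (any? _) (v , refl))))

  image-∈ : ∀ {w} → w ∈ image → ∃[ v ] f v ≡ w
  -- Abstracting the decision in both places turns the second equation into `false ≡ true` when no
  -- preimage exists.
  image-∈ {w} w∈ with any? (λ v → f v ≟ w)
                   | trans (sym (lookup∘tabulate (λ w → ⌊ any? (λ v → f v ≟ w) ⌋) w))
                           ([]=⇒lookup w∈)
  ... | yes p | _ = p
  ... | no _  | ()

-- Holds because any two proofs of membership in `S` are equal.
element-≡ : {S : Subset n} {x y : ∃[ v ] v ∈ S} → proj₁ x ≡ proj₁ y → x ≡ y
element-≡ refl = Σ-≡,≡→≡ (refl , []=-irrelevant _ _)

module _ {W : Set ℓ} {_≤_ : Rel W ℓ} {G H : LabelledGraph W} where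

  embedding⇒inducedSubgraph : LabelledEmbedding _≤_ G H → LabelledInducedSubgraph _≤_ G H
  embedding⇒inducedSubgraph e = image map , iso , map-label
    where
    open LabelledEmbedding e
    iso : graph (underlying G) ≅ (graph (underlying H) [ image map ])
    iso = record
      { bijection = mk↔ₛ′
          (λ v → map v , ∈-image map v)
          (λ w → proj₁ (image-∈ map (proj₂ w)))
          (λ w → element-≡ (proj₂ (image-∈ map (proj₂ w))))
          (λ v → injective (proj₂ (image-∈ map (∈-image map v))))
      ; preservesAdj = map-adj
      }

  inducedSubgraph⇒embedding : LabelledInducedSubgraph _≤_ G H → LabelledEmbedding _≤_ G H
  inducedSubgraph⇒embedding (S , iso , label-≤) = record
    { map       = proj₁ ∘ to
    ; injective = λ p → ↔-injective bijection (element-≡ p)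
    ; map-adj   = preservesAdj
    ; map-label = label-≤
    }
    where open _≅_ iso

-- Subsequences

stepwise : {A : Set a} {R : Rel A ℓ} → Transitive R → (f : ℕ → A) →
           (∀ i → R (f i) (f (suc i))) → ∀ {i j} → i < j → R (f i) (f j)
stepwise {R = R} R-trans f R-suc {i} {suc j} i<1+j with m<1+n⇒m<n∨m≡n i<1+j
... | inj₁ i<j  = R-trans (stepwise {R = R} R-trans f R-suc i<j) (R-suc j)
... | inj₂ refl = R-suc j

Increasing : (ℕ → ℕ) → Set
Increasing g = ∀ {i j} → i < j → g i < g j

increasing⇒injective : ∀ {g} → Increasing g → Injective _≡_ _≡_ g
increasing⇒injective g↑ {i} {j} gi≡gj with <-cmp i j
... | tri< i<j _ _ = contradiction (g↑ i<j) (<-irrefl gi≡gj)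
... | tri≈ _ i≡j _ = i≡j
... | tri> _ _ j<i = contradiction (g↑ j<i) (<-irrefl (sym gi≡gj))

module _ (em : ExcludedMiddle ℓ) (P : Pred ℕ ℓ) where

  -- If no tail lies in `P`, excluded middle finds a failure of `P` beyond every bound; iterating
  -- the search, each time from the successor of the last index, gives the subsequence.
  eventually⊎infinitelyOften¬ :
    (∃[ n ] (∀ m → n ≤ m → P m)) ⊎ (Σ[ g ∈ (ℕ → ℕ) ] Increasing g × (∀ i → ¬ P (g i)))
  eventually⊎infinitelyOften¬ with em {∃[ n ] (∀ m → n ≤ m → P m)}
  ... | yes p = inj₁ p
  ... | no ¬p = inj₂ (proj₁ ∘ g , stepwise {R = _<_} <-trans (proj₁ ∘ g) g-step , ¬P-g)
    where
    later : ∀ n → ∃[ m ] (n ≤ m × ¬ P m)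
    later n = decidable-stable em λ ¬q →
      ¬p (n , λ m n≤m → decidable-stable em λ ¬Pm → ¬q (m , n≤m , ¬Pm))
    g : ℕ → ∃[ m ] (¬ P m)
    g = fold (proj₁ (later 0) , proj₂ (proj₂ (later 0)))
             (λ (m , _) → let (m′ , _ , ¬Pm′) = later (suc m) in m′ , ¬Pm′)
    g-step : ∀ i → proj₁ (g i) < proj₁ (g (suc i))
    g-step i = proj₁ (proj₂ (later (suc (proj₁ (g i)))))
    ¬P-g : ∀ i → ¬ P (proj₁ (g i))
    ¬P-g i = proj₂ (g i)

  homogeneousSubsequence :
    Σ[ g ∈ (ℕ → ℕ) ] Increasing g × ((∀ i → P (g i)) ⊎ (∀ i → ¬ P (g i)))
  homogeneousSubsequence with eventually⊎infinitelyOften¬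
  ... | inj₁ (n , P-tail)   = (n +_) , +-monoʳ-< n , inj₁ (λ i → P-tail (n + i) (m≤m+n n i))
  ... | inj₂ (g , g↑ , ¬Pg) = g , g↑ , inj₂ ¬Pg

-- Well-quasi-orders

module _ {W : Set ℓ} {_⊑_ : Rel W ℓ} where

  wellQuasiOrder : (∀ {x} → x ⊑ x) → Transitive _⊑_ →
                   ((x : ℕ → W) → ∃[ i ] ∃[ j ] (i < j × x i ⊑ x j)) → IsWellQuasiOrder _⊑_
  wellQuasiOrder ⊑-refl ⊑-trans good = record
    { isQuasiOrder = record
        { isEquivalence = isEquivalence
        ; reflexive     = λ { refl → ⊑-refl }
        ; trans         = ⊑-trans
        }
    ; goodPair = good
    }

module _ (em : ExcludedMiddle ℓ) {W : Set ℓ} {_⊑_ : Rel W ℓ} (wqo : IsWellQuasiOrder _⊑_) where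
  open IsWellQuasiOrder wqo
  private
    module W = IsPreorder isQuasiOrder

  -- Call an index bad if no later term dominates its term. Infinitely many bad indices would give a
  -- sequence without a good pair, so from some `n` on every index has a dominating successor, and
  -- these are chained.
  ascendingSubsequence : (x : ℕ → W) →
    Σ[ g ∈ (ℕ → ℕ) ] Increasing g × (∀ {i j} → i < j → x (g i) ⊑ x (g j))
  ascendingSubsequence x
    with eventually⊎infinitelyOften¬ em (λ i → ∃[ j ] (i < j × x i ⊑ x j))
  ... | inj₂ (g , g↑ , bad) =
    let (i , j , i<j , xi⊑xj) = goodPair (x ∘ g)
    in contradiction (g j , g↑ i<j , xi⊑xj) (bad i)
  ... | inj₁ (n , better) = proj₁ ∘ g
                          , stepwise {R = _<_} <-trans (proj₁ ∘ g) (proj₁ ∘ next ∘ g)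
                          , stepwise {R = _⊑_} W.trans (x ∘ proj₁ ∘ g) (proj₂ ∘ next ∘ g)
    where
    next : (m : ∃[ m ] n ≤ m) → let m′ = proj₁ (better (proj₁ m) (proj₂ m)) in
           proj₁ m < m′ × x (proj₁ m) ⊑ x m′
    next (m , n≤m) = proj₂ (better m n≤m)
    g : ℕ → ∃[ m ] n ≤ m
    g = fold (n , ≤-refl) (λ (m , n≤m) →
      let (m′ , m<m′ , _) = better m n≤m in m′ , ≤-trans n≤m (<⇒≤ m<m′))

  -- A good pair for the second coordinate is sought along a subsequence that already ascends in the
  -- first.
  product-wqo : {W′ : Set ℓ} {_⊑′_ : Rel W′ ℓ} → IsWellQuasiOrder _⊑′_ →
                IsWellQuasiOrder {W = W × W′} (λ (v , v′) (w , w′) → v ⊑ w × v′ ⊑′ w′)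
  product-wqo wqo′ = wellQuasiOrder
    (W.refl , W′.refl)
    (λ (p , p′) (q , q′) → W.trans p q , W′.trans p′ q′)
    λ x → let (g , g↑ , ascends)  = ascendingSubsequence (proj₁ ∘ x)
              (i , j , i<j , ≤′) = wqo′.goodPair (proj₂ ∘ x ∘ g)
          in g i , g j , g↑ i<j , ascends i<j , ≤′
    where
    module wqo′ = IsWellQuasiOrder wqo′
    module W′ = IsPreorder wqo′.isQuasiOrder

  -- The Boolean is compared by equality, so embeddings respect a mark in both directions; by
  -- pigeonhole it is constant on a subsequence.
  ×Bool-wqo : IsWellQuasiOrder {W = W × Bool} (λ (v , b) (w , c) → v ⊑ w × b ≡ c)
  ×Bool-wqo = wellQuasiOrder (W.refl , refl) (λ (p , b) (q , c) → W.trans p q , trans b c) good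
    where
    good : (x : ℕ → W × Bool) →
           ∃[ i ] ∃[ j ] (i < j × proj₁ (x i) ⊑ proj₁ (x j) × proj₂ (x i) ≡ proj₂ (x j))
    good x =
      -- `Lift` brings the equation to the level at which excluded middle is assumed.
      let (g , g↑ , h)           = homogeneousSubsequence em (λ i → Lift ℓ (proj₂ (x i) ≡ true))
          (i , j , i<j , xi⊑xj) = goodPair (proj₁ ∘ x ∘ g)
      in g i , g j , g↑ i<j , xi⊑xj ,
         [ (λ t → trans (lower (t i)) (sym (lower (t j))))
         , (λ f → trans (¬-not (f i ∘ lift)) (sym (¬-not (f j ∘ lift)))) ]′ h

  -- `nothing` is comparable only to itself. Some subsequence avoids `nothing`, and `W` supplies the
  -- good pair, or is constantly `nothing`.
  Maybe-wqo : IsWellQuasiOrder (Pointwise _⊑_)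
  Maybe-wqo = wellQuasiOrder (Pointwise.refl W.refl) (Pointwise.trans W.trans) good
    where
    nothings : {p q : Maybe W} →
               ¬ (∃[ w ] p ≡ just w) → ¬ (∃[ w ] q ≡ just w) → Pointwise _⊑_ p q
    nothings {just w}            ¬p ¬q = contradiction (w , refl) ¬p
    nothings {nothing} {just w}  ¬p ¬q = contradiction (w , refl) ¬q
    nothings {nothing} {nothing} ¬p ¬q = nothing

    good : (x : ℕ → Maybe W) → ∃[ i ] ∃[ j ] (i < j × Pointwise _⊑_ (x i) (x j))
    good x with homogeneousSubsequence em (λ i → ∃[ w ] x i ≡ just w)
    ... | g , g↑ , inj₂ none = g 0 , g 1 , g↑ z<s , nothings (none 0) (none 1)
    ... | g , g↑ , inj₁ some =
      let (i , j , i<j , wi⊑wj) = goodPair (proj₁ ∘ some)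
      in g i , g j , g↑ i<j ,
         subst₂ (Pointwise _⊑_) (sym (proj₂ (some i))) (sym (proj₂ (some j))) (just wi⊑wj)

-- Transfer of labelled well-quasi-orderability along a relation on graphs

LabelledWQO-⊆ : {𝒜 ℬ : GraphClass ℓ} → (∀ G → 𝒜 G → ℬ G) → LabelledWQO ℬ → LabelledWQO 𝒜
LabelledWQO-⊆ 𝒜⊆ℬ wqo W _≤_ ≤-wqo (x , x∈𝒜 , anti) =
  wqo W _≤_ ≤-wqo (x , (λ i → 𝒜⊆ℬ _ (x∈𝒜 i)) , anti)

Image : GraphOperation → GraphClass ℓ → GraphClass ℓ
Image R 𝒢 H = ∃[ G ] (𝒢 G × R G H)

-- The full image is the right class to treat, since the property passes to subclasses.
record Transfers (ℓ : Level) (R : GraphOperation) : Set (lsuc ℓ) where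
  field
    transfer : (𝒢 : GraphClass ℓ) → LabelledWQO 𝒢 → LabelledWQO (Image R 𝒢)

open Transfers

labelled : {W : Set ℓ} (G : FiniteGraph) → (Fin (order G) → W) → LabelledGraph W
labelled G l = record { underlying = G ; label = l }

-- The labels of `H` and what is lost between `G` and `H` are stored as codes on `G`; `decode` says
-- that enough is stored to recover embeddings.
record Encoding (R : GraphOperation) {W : Set ℓ} (_≤_ : Rel W ℓ) : Set (lsuc ℓ) where
  field
    Code   : Set ℓ
    _⊑_    : Rel Code ℓ
    ⊑-wqo  : IsWellQuasiOrder _⊑_
    encode : ∀ {G H} → R G H → (Fin (order H) → W) → Fin (order G) → Code
    decode : ∀ {G H G′ H′} (r : R G H) (r′ : R G′ H′) (l : Fin (order H) → W) l′ →
             LabelledEmbedding _⊑_ (labelled G (encode r l)) (labelled G′ (encode r′ l′)) →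
             LabelledEmbedding _≤_ (labelled H l) (labelled H′ l′)

-- An antichain in the image is pulled back to its sources with encoded labels; a comparability
-- there would decode to one in the antichain.
encoding⇒transfers : {R : GraphOperation} →
  ({W : Set ℓ} {_≤_ : Rel W ℓ} → IsWellQuasiOrder _≤_ → Encoding R _≤_) → Transfers ℓ R
encoding⇒transfers {R = R} encoding .transfer 𝒢 𝒢-wqo W _≤_ ≤-wqo (x , x∈ , anti) =
  𝒢-wqo Code _⊑_ ⊑-wqo
    ( (λ i → labelled (proj₁ (x∈ i)) (encode (r i) (label (x i))))
    , (λ i → proj₁ (proj₂ (x∈ i)))
    , λ i j i≢j s → anti i j i≢j (embedding⇒inducedSubgraph
        (decode (r i) (r j) (label (x i)) (label (x j)) (inducedSubgraph⇒embedding s))))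
  where
  open Encoding (encoding ≤-wqo)
  r : ∀ i → R (proj₁ (x∈ i)) (underlying (x i))
  r i = proj₂ (proj₂ (x∈ i))

module _ {R S : GraphOperation} where

  transfers-⊆ : (∀ {G H} → R G H → S G H) → Transfers ℓ S → Transfers ℓ R
  transfers-⊆ R⊆S S-transfers .transfer 𝒢 𝒢-wqo W _≤_ ≤-wqo (x , x∈ , anti) =
    S-transfers .transfer 𝒢 𝒢-wqo W _≤_ ≤-wqo
      (x , (λ i → let (G , G∈ , r) = x∈ i in G , G∈ , R⊆S r) , anti)

  -- The intermediate graphs form the class `Image R 𝒢`, to which the hypothesis on `S` applies.
  transfers-∘ : Transfers ℓ R → Transfers ℓ S → Transfers ℓ (λ G K → ∃[ H ] (R G H × S H K))
  transfers-∘ R-transfers S-transfers .transfer 𝒢 𝒢-wqo W _≤_ ≤-wqo (x , x∈ , anti) =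
    S-transfers .transfer (Image R 𝒢) (R-transfers .transfer 𝒢 𝒢-wqo) W _≤_ ≤-wqo
      (x , (λ i → let (G , G∈ , H , r , s) = x∈ i in H , (G , G∈ , r) , s) , anti)

-- By pigeonhole an antichain in the image of `R` has an infinite part inside the image of `S` or
-- outside it, and the latter lies in the image of `T`.
transfers-∪ : ExcludedMiddle ℓ → {R S T : GraphOperation} → (∀ {G H} → R G H → S G H ⊎ T G H) →
              Transfers ℓ S → Transfers ℓ T → Transfers ℓ R
transfers-∪ em {R} {S} {T} R⊆S∪T S-transfers T-transfers .transfer 𝒢 𝒢-wqo W _≤_ ≤-wqo
            (x , x∈ , anti) =
  let (g , g↑ , h) = homogeneousSubsequence em (λ i → Image S 𝒢 (underlying (x i)))
      anti-g i j i≢j = anti (g i) (g j) (i≢j ∘ increasing⇒injective g↑)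
  in [ (λ ∈S → S-transfers .transfer 𝒢 𝒢-wqo W _≤_ ≤-wqo (x ∘ g , ∈S , anti-g))
     , (λ ∉S → T-transfers .transfer 𝒢 𝒢-wqo W _≤_ ≤-wqo
                 (x ∘ g , (λ i → T-rest (∉S i) (x∈ (g i))) , anti-g))
     ]′ h
  where
  T-rest : ∀ {H} → ¬ Image S 𝒢 H → Image R 𝒢 H → Image T 𝒢 H
  T-rest ∉S (G , G∈ , r) with R⊆S∪T r
  ... | inj₁ s = contradiction (G , G∈ , s) ∉S
  ... | inj₂ t = G , G∈ , t

-- Both complementations and isomorphism in one relation: subgraph
-- complementation is the case X = Y, isomorphism the case X = Y = ∅.

between : {V : Set} → (V → Bool) → (V → Bool) → V → V → Bool
between X Y u v = (X u ∧ Y v) ∨ (X v ∧ Y u)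

record Switching (G H : FiniteGraph) : Set where
  field
    bijection : Fin (order G) ↔ Fin (order H)
    X Y       : Fin (order G) → Bool
  open Inverse bijection public using (to; from; strictlyInverseˡ; strictlyInverseʳ)
  field
    -- Where `X` and `Y` overlap, `between X Y u u` is true although no loop may arise; hence the
    -- restriction to distinct vertices.
    switch    : ∀ {u v} → u ≢ v →
                adj (graph H) (to u) (to v) ≡ between X Y u v xor adj (graph G) u v

xor-moveˡ : ∀ p {x y} → p xor x ≡ y → x ≡ p xor y
xor-moveˡ p {x} refl = sym (trans (sym (xor-assoc p p x)) (cong (_xor x) (xor-same p)))

-- Xor with a fixed bit is an involution, so the same two sets, carried along the bijection, undo
-- the switching.
switching-sym : ∀ {G H} → Switching G H → Switching H G
switching-sym {G} {H} s = record
  { bijection = ↔-sym bijection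
  ; X         = X ∘ from
  ; Y         = Y ∘ from
  ; switch    = λ {u} {v} u≢v → xor-moveˡ (between X Y (from u) (from v)) (trans
      (sym (switch (u≢v ∘ ↔-injective (↔-sym bijection))))
      (cong₂ (adj (graph H)) (strictlyInverseˡ u) (strictlyInverseˡ v)))
  }
  where open Switching s

iso⇒switching : ∀ {G H} → graph G ≅ graph H → Switching G H
iso⇒switching iso = record
  { bijection = bijection
  ; X         = const false
  ; Y         = const false
  ; switch    = λ _ → preservesAdj _ _
  }
  where open _≅_ iso

if-not≡xor : ∀ b e → (if b then not e else e) ≡ b xor e
if-not≡xor true  e = refl
if-not≡xor false e = refl

distinct-≢ : {u v : Fin n} → u ≢ v → distinct u v ≡ true
distinct-≢ {u = u} {v} u≢v with u ≟ v
... | yes u≡v = contradiction u≡v u≢v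
... | no _    = refl

-- The isomorphism starts at `H`, so the switching is built from `H` to `G` with `S` pulled back,
-- and then reversed.
complementOn⇒switching : ∀ {G H} → subgraphComplementation G H → Switching G H
complementOn⇒switching {G} {H} (S , iso) = switching-sym record
  { bijection = bijection
  ; X         = lookup S ∘ to
  ; Y         = lookup S ∘ to
  ; switch    = λ {u} {v} u≢v → xor-moveˡ (between (lookup S) (lookup S) (to u) (to v)) (trans
      (cong (_xor adj (graph G) (to u) (to v)) (sym (pair u≢v)))
      (trans (sym (if-not≡xor ((lookup S (to u) ∧ lookup S (to v)) ∧ distinct (to u) (to v)) _))
             (preservesAdj u v)))
  }
  where
  open _≅_ iso
  pair : ∀ {u v} → u ≢ v →
         (lookup S (to u) ∧ lookup S (to v)) ∧ distinct (to u) (to v) ≡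
         between (lookup S) (lookup S) (to u) (to v)
  pair {u} {v} u≢v
    rewrite distinct-≢ (u≢v ∘ ↔-injective bijection)
          | ∧-comm (lookup S (to v)) (lookup S (to u))
    = trans (∧-identityʳ _) (sym (∨-idem _))

complementBetween⇒switching : ∀ {G H} → bipartiteComplementation G H → Switching G H
complementBetween⇒switching (X , Y , _ , iso) = switching-sym record
  { bijection = bijection
  ; X         = lookup X ∘ to
  ; Y         = lookup Y ∘ to
  ; switch    = λ {u} {v} _ → xor-moveˡ (between (lookup X) (lookup Y) (to u) (to v)) (trans
      (sym (if-not≡xor (between (lookup X) (lookup Y) (to u) (to v)) _))
      (preservesAdj u v))
  }
  where open _≅_ iso

-- The two bits record membership in `X` and `Y`. An embedding that preserves them and the adjacency
-- of `G` also preserves the switched adjacency, which is that of `H`.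
switching-encoding : ExcludedMiddle ℓ → {W : Set ℓ} {_≤_ : Rel W ℓ} →
                     IsWellQuasiOrder _≤_ → Encoding Switching _≤_
switching-encoding em {W} {_≤_} ≤-wqo = record
  { Code   = (W × Bool) × Bool
  ; ⊑-wqo  = ×Bool-wqo em (×Bool-wqo em ≤-wqo)
  ; encode = λ s l v → (l (to s v) , X s v) , Y s v
  ; decode = λ {G} {H} {G′} {H′} s s′ l l′ e →
      let open LabelledEmbedding e
          φ = λ u → to s′ (map (from s u))
          φ-injective : Injective _≡_ _≡_ φ
          φ-injective p = ↔-injective (↔-sym (bijection s))
                            (injective (↔-injective (bijection s′) p))
          X-map = proj₂ ∘ proj₁ ∘ map-label
          Y-map = proj₂ ∘ map-label
          switch-map : ∀ {u v} → u ≢ v →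
                       adj (graph H′) (to s′ (map u)) (to s′ (map v)) ≡
                       adj (graph H) (to s u) (to s v)
          switch-map {u} {v} u≢v = trans (switch s′ (u≢v ∘ injective)) (trans
            (sym (cong₂ _xor_
              (cong₂ _∨_ (cong₂ _∧_ (X-map u) (Y-map v)) (cong₂ _∧_ (X-map v) (Y-map u)))
              (sym (map-adj u v))))
            (sym (switch s u≢v)))
          φ-adj : ∀ u v → adj (graph H′) (φ u) (φ v) ≡ adj (graph H) u v
          -- `switch` covers distinct vertices only; equal ones are non-adjacent on both sides.
          φ-adj u v = case-≟ u v
            (λ { refl → trans (adj-irrefl (graph H′) (φ u)) (sym (adj-irrefl (graph H) u)) })
            (λ u≢v → trans
              (switch-map (u≢v ∘ ↔-injective (↔-sym (bijection s))))
              (cong₂ (adj (graph H)) (strictlyInverseˡ s u) (strictlyInverseˡ s v)))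
      in record
        { map       = φ
        ; injective = φ-injective
        ; map-adj   = φ-adj
        ; map-label = λ v → subst (λ w → l w ≤ l′ (φ v)) (strictlyInverseˡ s v)
                              (proj₁ (proj₁ (map-label (from s v))))
        }
  }
  where
  open Switching
  case-≟ : ∀ {n} (u v : Fin n) {A : Set} → (u ≡ v → A) → (u ≢ v → A) → A
  case-≟ u v f g with u ≟ v
  ... | yes p = f p
  ... | no ¬p = g ¬p

-- Vertex deletion

-- `nothing` stands for the deleted vertex, whose adjacencies are left unconstrained.
record Deletion (G H : FiniteGraph) : Set where
  field
    bijection : Fin (order G) ↔ Maybe (Fin (order H))
  open Inverse bijection public using (to; from; strictlyInverseˡ; strictlyInverseʳ)
  field
    adj-from  : ∀ u v → adj (graph G) (from (just u)) (from (just v)) ≡ adj (graph H) u v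

  from-injective : Injective _≡_ _≡_ from
  from-injective = ↔-injective (↔-sym bijection)

vertexDeletion⇒deletion : ∀ {G H} → vertexDeletion G H → Deletion G H
vertexDeletion⇒deletion {G} {H} (d , iso) = record
  { bijection = mk↔ₛ′ to from to∘from from∘to
  ; adj-from  = iso.preservesAdj
  }
  where
  module iso = _≅_ iso
  module bijection = Inverse iso.bijection

  ≢⇒∈ : ∀ {v} → v ≢ d → v ∈ ∁ ⁅ d ⁆
  ≢⇒∈ v≢d = x∉p⇒x∈∁p (v≢d ∘ x∈⁅y⁆⇒x≡y d)

  to : Fin (order G) → Maybe (Fin (order H))
  to v with v ≟ d
  ... | yes _  = nothing
  ... | no v≢d = just (iso.from (v , ≢⇒∈ v≢d))

  from : Maybe (Fin (order H)) → Fin (order G)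
  from nothing  = d
  from (just u) = proj₁ (iso.to u)

  to∘from : ∀ u → to (from u) ≡ u
  to∘from nothing with d ≟ d
  ... | yes _  = refl
  ... | no d≢d = contradiction refl d≢d
  to∘from (just u) with proj₁ (iso.to u) ≟ d
  ... | yes u≡d = contradiction (subst (_∈ ⁅ d ⁆) (sym u≡d) (x∈⁅x⁆ d))
                                (x∈∁p⇒x∉p (proj₂ (iso.to u)))
  -- The membership proof rebuilt by `to` need not be the original one; `element-≡` identifies the
  -- two.
  ... | no _    = cong just (trans (cong iso.from (element-≡ refl)) (bijection.strictlyInverseʳ u))

  from∘to : ∀ v → from (to v) ≡ v
  from∘to v with v ≟ d
  ... | yes v≡d = sym v≡d
  ... | no v≢d  = cong proj₁ (bijection.strictlyInverseˡ (v , ≢⇒∈ v≢d))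

-- The deleted vertex is marked `nothing`. As `just` lies below `just` only, survivors go to
-- survivors, and the embedding restricts to them.
deletion-encoding : ExcludedMiddle ℓ → {W : Set ℓ} {_≤_ : Rel W ℓ} →
                    IsWellQuasiOrder _≤_ → Encoding Deletion _≤_
deletion-encoding em {W} {_≤_} ≤-wqo = record
  { Code   = Maybe W
  ; _⊑_    = Pointwise _≤_
  ; ⊑-wqo  = Maybe-wqo em ≤-wqo
  ; encode = λ δ l v → Maybe.map l (to δ v)
  ; decode = λ {G} {H} {G′} {H′} δ δ′ l l′ e →
      let open LabelledEmbedding e
          survivor : ∀ u → ∃[ u′ ] (to δ′ (map (from δ (just u))) ≡ just u′ × l u ≤ l′ u′)
          -- The transport turns the code at `from δ (just u)` into `just (l u)`, so its image must
          -- also carry a `just`.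
          survivor u = just-map (subst (λ p → Pointwise _≤_ (Maybe.map l p) _)
                                   (strictlyInverseˡ δ (just u)) (map-label (from δ (just u))))
          φ = proj₁ ∘ survivor
          from-φ : ∀ u → from δ′ (just (φ u)) ≡ map (from δ (just u))
          from-φ u = trans (cong (from δ′) (sym (proj₁ (proj₂ (survivor u)))))
                           (strictlyInverseʳ δ′ _)
      in record
        { map       = φ
        ; injective = λ {u} {v} p → just-injective (from-injective δ (injective
            (trans (sym (from-φ u)) (trans (cong (from δ′ ∘ just) p) (from-φ v)))))
        ; map-adj   = λ u v → trans (sym (adj-from δ′ (φ u) (φ v))) (trans
            (cong₂ (adj (graph G′)) (from-φ u) (from-φ v))
            (trans (map-adj _ _) (adj-from δ u v)))
        ; map-label = λ u → proj₂ (proj₂ (survivor u))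
        }
  }
  where
  open Deletion
  just-map : {A : Set} {w : W} {l : A → W} {p : Maybe A} →
             Pointwise _≤_ (just w) (Maybe.map l p) → ∃[ u ] (p ≡ just u × w ≤ l u)
  just-map {p = just u} (just w≤lu) = u , refl , w≤lu

-- The label of the lost vertex is stored at the remaining vertices, so one is needed.
NonemptyInsertion : GraphOperation
NonemptyInsertion H G = Fin (order H) × Deletion G H

-- An embedding of the smaller graphs is extended by sending lost vertex to lost vertex; the stored
-- bit makes the extension respect adjacency to it.
insertion-encoding : ExcludedMiddle ℓ → {W : Set ℓ} {_≤_ : Rel W ℓ} →
                     IsWellQuasiOrder _≤_ → Encoding NonemptyInsertion _≤_
insertion-encoding em {W} {_≤_} ≤-wqo = record
  { Code   = (W × W) × Bool
  ; ⊑-wqo  = ×Bool-wqo em (product-wqo em ≤-wqo ≤-wqo)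
  ; encode = λ {_} {G} (_ , δ) l u →
      (l (from δ (just u)) , l (from δ nothing)) , adj (graph G) (from δ nothing) (from δ (just u))
  ; decode = λ {H} {G} {H′} {G′} (u₀ , δ) (_ , δ′) l l′ e →
      let open LabelledEmbedding e
          φ : Maybe (Fin (order H)) → Fin (order G′)
          φ p = from δ′ (Maybe.map map p)
          φ-label : ∀ p → l (from δ p) ≤ l′ (φ p)
          -- Every vertex stores the label of the lost one; it is read off at `u₀`.
          φ-label = λ { nothing  → proj₂ (proj₁ (map-label u₀))
                      ; (just u) → proj₁ (proj₁ (map-label u)) }
          φ-adj : ∀ p q → adj (graph G′) (φ p) (φ q) ≡ adj (graph G) (from δ p) (from δ q)
          φ-adj = λ
            { nothing  nothing  → trans (adj-irrefl (graph G′) _) (sym (adj-irrefl (graph G) _))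
            ; nothing  (just v) → sym (proj₂ (map-label v))
            ; (just u) nothing  → trans (adj-sym (graph G′) _ _) (trans
                                    (sym (proj₂ (map-label u))) (adj-sym (graph G) _ _))
            ; (just u) (just v) → trans (adj-from δ′ _ _) (trans
                                    (map-adj u v) (sym (adj-from δ u v))) }
      in record
        { map       = φ ∘ to δ
        ; injective = λ p → ↔-injective (bijection δ)
                              (map-injective injective (from-injective δ′ p))
        ; map-adj   = λ u v → trans (φ-adj (to δ u) (to δ v))
            (cong₂ (adj (graph G)) (strictlyInverseʳ δ u) (strictlyInverseʳ δ v))
        ; map-label = λ v → subst (λ w → l w ≤ l′ (φ (to δ v))) (strictlyInverseʳ δ v)
                              (φ-label (to δ v))
        }
  }
  where open Deletion

-- Insertion into the empty graph, and both directions of deletion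

Singleton : FiniteGraph → Set
Singleton G = Σ[ v ∈ Fin (order G) ] ∀ u → v ≡ u

-- One-vertex graphs are compared through their single labels, so a good pair of labels already
-- refutes an antichain.
singleton-transfers : Transfers ℓ (λ _ → Singleton)
singleton-transfers .transfer _ _ W _≤_ ≤-wqo (x , x∈ , anti) =
  let (i , j , i<j , le) = goodPair (λ i → label (x i) (point i))
  in anti i j (λ i≡j → <-irrefl i≡j i<j)
       (embedding⇒inducedSubgraph {_≤_ = _≤_} {G = x i} {H = x j} record
         { map       = const (point j)
         ; injective = λ _ → trans (sym (only i _)) (only i _)
         ; map-adj   = λ u v → trans (adj-irrefl (graph (underlying (x j))) _) (trans
             (sym (adj-irrefl (graph (underlying (x i))) (point i)))
             (cong₂ (adj (graph (underlying (x i)))) (only i u) (only i v)))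
         ; map-label = λ v → subst (λ w → label (x i) w ≤ label (x j) (point j)) (only i v) le
         })
  where
  open IsWellQuasiOrder ≤-wqo
  point : ∀ i → Fin (order (underlying (x i)))
  point i = proj₁ (proj₂ (proj₂ (x∈ i)))
  only : ∀ i v → point i ≡ v
  only i = proj₂ (proj₂ (proj₂ (x∈ i)))

insertion⇒singleton⊎nonempty : ∀ {G H} → Deletion G H → Singleton G ⊎ NonemptyInsertion H G
insertion⇒singleton⊎nonempty {H = finiteGraph {suc _} _} δ = inj₂ (zero , δ)
insertion⇒singleton⊎nonempty {H = finiteGraph {zero} _} δ = inj₁ (from nothing , only)
  where
  open Deletion δ
  only : ∀ u → from nothing ≡ u
  -- `Fin zero` is empty, so `to u` can only be `nothing`.
  only u with to u | strictlyInverseʳ u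
  ... | nothing | p = p

deletion-transfers : ExcludedMiddle ℓ → Transfers ℓ vertexDeletion
deletion-transfers em =
  transfers-⊆ vertexDeletion⇒deletion (encoding⇒transfers (deletion-encoding em))

insertion-transfers : ExcludedMiddle ℓ → Transfers ℓ (flip vertexDeletion)
insertion-transfers em =
  transfers-∪ em (insertion⇒singleton⊎nonempty ∘ vertexDeletion⇒deletion)
    singleton-transfers (encoding⇒transfers (insertion-encoding em))

-- Iterating an operation

module _ (em : ExcludedMiddle ℓ) where

  switching-transfers : Transfers ℓ Switching
  switching-transfers = encoding⇒transfers (switching-encoding em)

  module _ {γ : GraphOperation} where

    -- Induction on `k`: `stop` is a switching with empty sets, and `step` is a composition with a
    -- shorter run.
    AtMost-transfers : Transfers ℓ γ → ∀ k → Transfers ℓ (AtMost γ k)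
    AtMost-transfers γ-transfers zero =
      transfers-⊆ (λ { (stop iso) → iso⇒switching iso }) switching-transfers
    AtMost-transfers γ-transfers (suc k) = transfers-∪ em
      (λ { (stop iso) → inj₁ (iso⇒switching iso) ; (step g s) → inj₂ (_ , g , s) })
      switching-transfers
      (transfers-∘ γ-transfers (AtMost-transfers γ-transfers k))

    -- Read backwards, the run after the first operation is undone first, which reverses the order
    -- of composition.
    flip-AtMost-transfers : Transfers ℓ (flip γ) → ∀ k → Transfers ℓ (flip (AtMost γ k))
    flip-AtMost-transfers γ⁻-transfers zero =
      transfers-⊆ (λ { (stop iso) → switching-sym (iso⇒switching iso) }) switching-transfers
    flip-AtMost-transfers γ⁻-transfers (suc k) = transfers-∪ em
      (λ { (stop iso) → inj₁ (switching-sym (iso⇒switching iso)) ; (step g s) → inj₂ (_ , s , g) })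
      switching-transfers
      (transfers-∘ (flip-AtMost-transfers γ⁻-transfers k) γ⁻-transfers)

    -- `every-to` places `𝒢` in the backward image of `𝒢′`, and `every-from` places `𝒢′` in the
    -- forward image of `𝒢`.
    transfers⇒preserves : Transfers ℓ γ → Transfers ℓ (flip γ) → PreservesLabelledWQO ℓ γ
    transfers⇒preserves γ-transfers γ⁻-transfers k 𝒢 𝒢′ obtained = mk⇔
      (LabelledWQO-⊆ every-to ∘ flip-AtMost-transfers γ⁻-transfers k .transfer 𝒢′)
      (LabelledWQO-⊆ every-from ∘ AtMost-transfers γ-transfers k .transfer 𝒢)
      where open Obtained obtained

    -- Since switching is symmetric, one encoding serves both directions.
    switching⇒preserves : (∀ {G H} → γ G H → Switching G H) → PreservesLabelledWQO ℓ γ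
    switching⇒preserves γ⊆ = transfers⇒preserves
      (transfers-⊆ γ⊆ switching-transfers)
      (transfers-⊆ (switching-sym ∘ γ⊆) switching-transfers)

lemma5 : ∀ {ℓ} → ExcludedMiddle ℓ →
    PreservesLabelledWQO ℓ subgraphComplementation ×
    PreservesLabelledWQO ℓ bipartiteComplementation ×
    PreservesLabelledWQO ℓ vertexDeletion
lemma5 em =
    switching⇒preserves em complementOn⇒switching
  , switching⇒preserves em complementBetween⇒switching
  , transfers⇒preserves em (deletion-transfers em) (insertion-transfers em)
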